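{- For every integer $k\ge 0$, let $t_k=3^k\cdot 6^{(4^k-3k-1)/9}$. Then every graph $G$ with tree-width $\mathrm{tw}(G)\le k$ has a $t_k$-track layout.
   Context: All graphs are finite, simple and undirected. A colouring of $G$ is a partition $\{V_i:i\in I\}$ of $V(G)$ such that no edge has both end-vertices in the same class. A track assignment is a colouring together with a total order $<_i$ of each $V_i$ (each $(V_i,<_i)$ is a track). An X-crossing consists of two edges $vw$, $xy$ with $v,x\in V_i$, $w,y\in V_j$ for distinct tracks $i\neq j$, $v<_i x$ and $y<_j w$. A $t$-track layout is a track assignment with $t$ tracks and no X-crossing. -}

module Defs where

open import Level using (0ℓ)
open import Data.Nat using (ℕ; zero; suc; _+_; _*_; _∸_; _^_; _≤_; _/_)
open import Data.Fin using (Fin; zero; suc; inject₁; fromℕ)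
open import Data.Fin.Subset using (Subset; _∈_; ∣_∣)
open import Data.Product using (Σ; ∃; _×_; _,_)
open import Data.Sum using (_⊎_)
open import Data.Unit using (⊤)
open import Data.Empty using (⊥)
open import Relation.Nullary using (¬_)
open import Relation.Binary.PropositionalEquality using (_≡_; _≢_)

record Graph : Set₁ where
  field
    n     : ℕ
    Adj   : Fin n → Fin n → Set
    sym   : ∀ {u v} → Adj u v → Adj v u
    irrefl : ∀ {u} → ¬ Adj u u

open Graph public

V : Graph → Set
V G = Fin (n G)

data WalkIn (G : Graph) (P : V G → Set) : V G → V G → Set where
  nil  : ∀ {a} → P a → WalkIn G P a a
  cons : ∀ {a c b} → P a → Adj G a c → WalkIn G P c b → WalkIn G P a b

Connected : Graph → Set
Connected G = ∀ a b → WalkIn G (λ _ → ⊤) a b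

InducesConnected : (G : Graph) → (V G → Set) → Set
InducesConnected G S = ∀ a b → S a → S b → WalkIn G S a b

Cycle : Graph → Set
Cycle G = Σ ℕ λ l → Σ (Fin (suc (suc (suc l))) → V G) λ f →
  (∀ i j → f i ≡ f j → i ≡ j) ×
  (∀ (i : Fin (suc (suc l))) → Adj G (f (inject₁ i)) (f (suc i))) ×
  Adj G (f (fromℕ (suc (suc l)))) (f zero)

Acyclic : Graph → Set
Acyclic G = ¬ Cycle G

IsTree : Graph → Set
IsTree T = Connected T × Acyclic T

record TreeDecomposition (G : Graph) (k : ℕ) : Set₁ where
  field
    T        : Graph
    isTree   : IsTree T
    bag      : V T → Subset (n G)
    cover    : ∀ (v : V G) → ∃ λ x → v ∈ bag x
    edgeCov  : ∀ {v w : V G} → Adj G v w → ∃ λ x → (v ∈ bag x × w ∈ bag x)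
    subtree  : ∀ (v : V G) → InducesConnected T (λ x → v ∈ bag x)
    width    : ∀ (x : V T) → ∣ bag x ∣ ≤ suc k

TreeWidthAtMost : Graph → ℕ → Set₁
TreeWidthAtMost G k = TreeDecomposition G k

record TrackLayout (G : Graph) (t : ℕ) : Set₁ where
  field
    col      : V G → Fin t
    proper   : ∀ {u v} → Adj G u v → col u ≢ col v
    _<ₜ_     : V G → V G → Set
    ord-same : ∀ {u v} → u <ₜ v → col u ≡ col v
    ord-irr  : ∀ {u} → ¬ (u <ₜ u)
    ord-trans : ∀ {u v w} → u <ₜ v → v <ₜ w → u <ₜ w
    ord-total : ∀ {u v} → col u ≡ col v → u ≢ v → (u <ₜ v) ⊎ (v <ₜ u)
    noX      : ∀ {v w x y} → Adj G v w → Adj G x y →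
               col v ≡ col x → col w ≡ col y → col v ≢ col w →
               v <ₜ x → y <ₜ w → ⊥

t : ℕ → ℕ
t k = 3 ^ k * 6 ^ ((4 ^ k ∸ 3 * k ∸ 1) / 9)

{-# OPTIONS --safe #-}

-- A graph of tree-width at most k is a subgraph of a chordal graph in which the earlier neighbours
-- of each vertex form a clique of size at most k.  Layer the chordal graph by distance from the
-- roots of its components.  The edges inside the layers form such a graph for k - 1, and its
-- components, the bags, are the nodes of a forest: all edges from a bag to the previous layer end
-- in one clique, contained in one bag.  Given a layout for k - 1 in which the cliques are divided
-- into s types, each type linearly ordered colour by colour, colour a vertex by its depth mod 3,
-- the type of the clique to which its bag is attached, and its old colour; order the vertices by
-- depth, then by bag, then by the old order.  A clique of the new graph meets at most two
-- consecutive layers, so 3 s (s + s^3) <= 6 s^4 types suffice for it.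
module Submission where

open import Defs renaming (sym to Adj-sym)
open import Data.Empty using (⊥; ⊥-elim)
open import Data.Fin using (Fin; zero; suc; toℕ; combine; inject₁; fromℕ)
open import Data.Fin.Properties using (combine-injective; toℕ-injective; toℕ<n)
  renaming (_≟_ to _≟ᶠ_; any? to anyᶠ?)
open import Data.Fin.Subset using (Subset; inside; outside; ∣_∣) renaming (_∈_ to _∈ₛ_)
open import Data.Fin.Subset.Properties using () renaming (_∈?_ to _∈ₛ?_)
open import Data.List using (List; []; _∷_; filter; length; map)
open import Data.List.Membership.Propositional using (_∈_; find; lose)
open import Data.List.Membership.Propositional.Properties
  using (∈-filter⁺; ∈-filter⁻; ∈-map⁺; ∈-map⁻)
open import Data.List.Properties using (filter-notAll; length-map)
open import Data.List.Relation.Unary.Any using (here; there; any?)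
open import Data.Nat
open import Data.Nat.DivMod using (m*n/n≡m)
open import Data.Nat.Induction using (<-wellFounded)
open import Data.Nat.Properties
open import Data.Nat.Tactic.RingSolver using (solve-∀)
open import Data.Product using (∃; _×_; _,_; proj₁; proj₂)
open import Data.Sum using (_⊎_; inj₁; inj₂)
open import Data.Unit using (⊤)
open import Data.Vec using (Vec; []; _∷_; lookup; here; there)
open import Function using (_∘_; case_of_)
open import Induction.WellFounded using (module All)
open import Relation.Binary.Construct.On using () renaming (wellFounded to on-wellFounded)
open import Relation.Binary.PropositionalEquality
  using (_≡_; _≢_; refl; trans; cong; cong₂; subst; module ≡-Reasoning) renaming (sym to ≡-sym)
open import Relation.Nullary using (¬_; Dec; yes; no; ¬?)

-- Sums, lexicographic codes, residues mod 3 and minima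

sumFin : ∀ {m} → (Fin m → ℕ) → ℕ
sumFin {zero}  f = 0
sumFin {suc m} f = f zero + sumFin (f ∘ suc)

sumFin-mono-≤ : ∀ {m} {f g : Fin m → ℕ} → (∀ i → f i ≤ g i) → sumFin f ≤ sumFin g
sumFin-mono-≤ {zero}  f≤g = z≤n
sumFin-mono-≤ {suc m} f≤g = +-mono-≤ (f≤g zero) (sumFin-mono-≤ (f≤g ∘ suc))

sumFin-mono-< : ∀ {m} {f g : Fin m → ℕ} → (∀ i → f i ≤ g i) →
                ∀ j → f j < g j → sumFin f < sumFin g
sumFin-mono-< f≤g zero    fj<gj = +-mono-<-≤ fj<gj (sumFin-mono-≤ (f≤g ∘ suc))
sumFin-mono-< f≤g (suc j) fj<gj = +-mono-≤-< (f≤g zero) (sumFin-mono-< (f≤g ∘ suc) j fj<gj)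

f≤sumFin : ∀ {m} (f : Fin m → ℕ) i → f i ≤ sumFin f
f≤sumFin f zero    = m≤m+n _ _
f≤sumFin f (suc i) = ≤-trans (f≤sumFin (f ∘ suc) i) (m≤n+m _ _)

-- Lexicographic orders are coded below as `a * N + b`: a last digit `b′` below `N` cannot make up
-- for a smaller leading digit.
*+-cancel-≤ : ∀ N {a a′ b b′} → b′ < N → a * N + b ≤ a′ * N + b′ → a ≤ a′
*+-cancel-≤ N {a} {a′} {b} {b′} b′<N le = ≮⇒≥ λ a′<a → <-irrefl refl (begin-strict
  a′ * N + b′  <⟨ +-monoʳ-< (a′ * N) b′<N ⟩
  a′ * N + N   ≡⟨ +-comm (a′ * N) N ⟩
  suc a′ * N   ≤⟨ *-monoˡ-≤ N a′<a ⟩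
  a * N        ≤⟨ m≤m+n (a * N) b ⟩
  a * N + b    ≤⟨ le ⟩
  a′ * N + b′  ∎)
  where open ≤-Reasoning

cycle3 : Fin 3 → Fin 3
cycle3 zero             = suc zero
cycle3 (suc zero)       = suc (suc zero)
cycle3 (suc (suc zero)) = zero

mod3 : ℕ → Fin 3
mod3 zero    = zero
mod3 (suc m) = cycle3 (mod3 m)

cycle3-≢ : ∀ i → i ≢ cycle3 i
cycle3-≢ zero             ()
cycle3-≢ (suc zero)       ()
cycle3-≢ (suc (suc zero)) ()

-- Depths are taken mod 3 rather than mod 2 because of this: a step down and a step up between
-- layers must be told apart.
cycle3²-≢ : ∀ i → i ≢ cycle3 (cycle3 i)
cycle3²-≢ zero             ()
cycle3²-≢ (suc zero)       ()
cycle3²-≢ (suc (suc zero)) ()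

lowest : {A : Set} → (A → ℕ) → List A → ℕ
lowest f []           = 0
lowest f (x ∷ [])     = f x
lowest f (x ∷ y ∷ ys) = f x ⊓ lowest f (y ∷ ys)

module _ {A : Set} where

  lowest-≤ : ∀ (f : A → ℕ) {x xs} → x ∈ xs → lowest f xs ≤ f x
  lowest-≤ f {xs = x ∷ []}     (here refl) = ≤-refl
  lowest-≤ f {xs = x ∷ y ∷ ys} (here refl) = m⊓n≤m _ _
  lowest-≤ f {xs = x ∷ y ∷ ys} (there p)   = ≤-trans (m⊓n≤n _ _) (lowest-≤ f p)

  lowest-attained : ∀ (f : A → ℕ) {x xs} → x ∈ xs → ∃ λ y → y ∈ xs × lowest f xs ≡ f y
  lowest-attained f {xs = x ∷ []}     _ = x , here refl , refl
  lowest-attained f {xs = x ∷ y ∷ ys} _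
    with lowest-attained f {xs = y ∷ ys} (here refl) | ⊓-sel (f x) (lowest f (y ∷ ys))
  ... | _             | inj₁ eq = x , here refl , eq
  ... | z , z∈ , low≡ | inj₂ eq = z , there z∈ , trans eq low≡

  lowest-cong : ∀ {f g : A → ℕ} xs → (∀ {x} → x ∈ xs → f x ≡ g x) → lowest f xs ≡ lowest g xs
  lowest-cong []           f≡g = refl
  lowest-cong (x ∷ [])     f≡g = f≡g (here refl)
  lowest-cong (x ∷ y ∷ ys) f≡g = cong₂ _⊓_ (f≡g (here refl)) (lowest-cong (y ∷ ys) (f≡g ∘ there))

-- Recursion along a measure

module MeasuredRecursion {A : Set} (ord : A → ℕ) where

  measure-induction : (P : A → Set) → (∀ v → (∀ {u} → ord u < ord v → P u) → P v) → ∀ v → P v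
  measure-induction = All.wfRec (on-wellFounded ord <-wellFounded) _

  module Fixpoint {B : Set} (b₀ : B) (F : (A → B) → A → B)
    (F-local : ∀ {f g} v → (∀ {u} → ord u < ord v → f u ≡ g u) → F f v ≡ F g v) where

    iterate : ℕ → A → B
    iterate zero    v = b₀
    iterate (suc i) v = F (iterate i) v

    -- `F-local` confines each call to arguments of smaller measure, so the iteration count is fuel,
    -- and any amount above `ord v` is enough.
    iterate-stable : ∀ i j v → ord v < i → ord v < j → iterate i v ≡ iterate j v
    iterate-stable (suc i) (suc j) v (s≤s v≤i) (s≤s v≤j) = F-local v λ {u} u<v →
      iterate-stable i j u (<-≤-trans u<v v≤i) (<-≤-trans u<v v≤j)

    abstract
      fix : A → B
      fix v = iterate (suc (ord v)) v

      fix-unfold : ∀ v → fix v ≡ F fix v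
      fix-unfold v = F-local v λ {u} u<v → iterate-stable (ord v) (suc (ord u)) u u<v ≤-refl

-- Elimination orders and layouts with clique types

-- A perfect elimination order of a chordal graph of clique number at most k + 1:
-- `back v` lists the neighbours of v that precede it.
record EliminationOrder (n k : ℕ) : Set where
  field
    ord  : Fin n → ℕ
    back : Fin n → List (Fin n)

  Near : Fin n → Fin n → Set
  Near u v = u ∈ back v ⊎ v ∈ back u

  Clique : List (Fin n) → Set
  Clique C = ∀ {u v} → u ∈ C → v ∈ C → u ≡ v ⊎ Near u v

  field
    back-<      : ∀ {u v} → u ∈ back v → ord u < ord v
    back-clique : ∀ v → Clique (back v)
    back-length : ∀ v → length (back v) ≤ k

  near-sym : ∀ {u v} → Near u v → Near v u
  near-sym (inj₁ p) = inj₂ p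
  near-sym (inj₂ p) = inj₁ p

-- `cliqueType` determines the set of colours of a clique; with `no-crossing` this makes the
-- cliques of one type linearly ordered, colour by colour.
record CliqueLayout {n k : ℕ} (H : EliminationOrder n k) (t s : ℕ) : Set where
  open EliminationOrder H
  field
    colour         : Fin n → Fin t
    rank           : Fin n → ℕ
    rank-injective : ∀ {u v} → rank u ≡ rank v → u ≡ v
    proper         : ∀ {u v} → Near u v → colour u ≢ colour v
    no-crossing    : ∀ {v w x y} → Near v w → Near x y → colour v ≡ colour x →
                     colour w ≡ colour y → rank v < rank x → rank y < rank w → ⊥
    cliqueType     : List (Fin n) → Fin s
    type-colours   : ∀ {C D w y} → Clique C → Clique D → w ∈ C → y ∈ D →
                     cliqueType C ≡ cliqueType D → ∃ λ z → z ∈ D × colour w ≡ colour z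

  colour-injective : ∀ {C v w} → Clique C → v ∈ C → w ∈ C → colour v ≡ colour w → v ≡ w
  colour-injective cl v∈ w∈ eq with cl v∈ w∈
  ... | inj₁ v≡w = v≡w
  ... | inj₂ v~w = ⊥-elim (proper v~w eq)

  -- Otherwise the edges `v w` and `x y` would cross. In the degenerate cases, two vertices of one
  -- clique with equal colours coincide.
  clique-monotone : ∀ {C D v w x y} → Clique C → Clique D → v ∈ C → x ∈ D → colour v ≡ colour x →
                    rank v < rank x → w ∈ C → y ∈ D → colour w ≡ colour y → rank w ≤ rank y
  clique-monotone {w = w} {y = y} clC clD v∈ x∈ cv≡cx v<x w∈ y∈ cw≡cy = ≮⇒≥ crossing
    where
    crossing : ¬ rank y < rank w
    crossing y<w with clC v∈ w∈ | clD x∈ y∈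
    ... | inj₂ v~w  | inj₂ x~y  = no-crossing v~w x~y cv≡cx cw≡cy v<x y<w
    ... | inj₂ v~w  | inj₁ refl = proper v~w (trans cv≡cx (≡-sym cw≡cy))
    ... | inj₁ refl | _
      with colour-injective clD x∈ y∈ (trans (≡-sym cv≡cx) cw≡cy)
    ... | refl = <-asym v<x y<w

  rankAt : List (Fin n) → Fin t → ℕ
  rankAt C c with any? (λ v → colour v ≟ᶠ c) C
  ... | yes p = rank (proj₁ (find p))
  -- The default is the least value, so a colour missing from `C` never spoils the comparison of `C`
  -- with a later clique.
  ... | no _  = 0

  rankAt-∈ : ∀ {C v c} → Clique C → v ∈ C → colour v ≡ c → rankAt C c ≡ rank v
  rankAt-∈ {C} {v} {c} cl v∈ cv≡c with any? (λ v → colour v ≟ᶠ c) C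
  ... | no ¬p = ⊥-elim (¬p (lose v∈ cv≡c))
  ... | yes p with find p
  ...   | w , w∈ , cw≡c = cong rank (colour-injective cl w∈ v∈ (trans cw≡c (≡-sym cv≡c)))

  position : List (Fin n) → ℕ
  position C = sumFin (rankAt C)

  -- By `clique-monotone` no colour goes the other way, so the sum of the ranks grows; `position`
  -- thus numbers the cliques of one type compatibly with their order.
  position-< : ∀ {C D v x} → Clique C → Clique D → cliqueType C ≡ cliqueType D →
               v ∈ C → x ∈ D → colour v ≡ colour x → rank v < rank x → position C < position D
  position-< {C} {D} {v} {x} clC clD same v∈ x∈ cv≡cx v<x = sumFin-mono-< below (colour x)
    (≤-trans (s≤s (≤-reflexive (rankAt-∈ clC v∈ cv≡cx)))
             (≤-trans v<x (≤-reflexive (≡-sym (rankAt-∈ clD x∈ refl)))))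
    where
    below : ∀ c → rankAt C c ≤ rankAt D c
    below c with any? (λ v → colour v ≟ᶠ c) C
    ... | no _  = z≤n
    ... | yes p with find p
    ...   | w , w∈ , cw≡c with type-colours clC clD w∈ x∈ same
    ...     | y , y∈ , cw≡cy = ≤-trans (clique-monotone clC clD v∈ x∈ cv≡cx v<x w∈ y∈ cw≡cy)
                (≤-reflexive (≡-sym (rankAt-∈ clD y∈ (trans (≡-sym cw≡cy) cw≡c))))

-- Layers, bags and the cliques to which bags are attached

module Layering {n k : ℕ} (H : EliminationOrder n (suc k)) where
  open EliminationOrder H
  open MeasuredRecursion ord

  -- Distance from the root of the component. Earlier neighbours suffice: if a path passes through a
  -- vertex later than both its neighbours on the path, these are equal or adjacent, and the vertex
  -- can be skipped.
  depthStep : (Fin n → ℕ) → List (Fin n) → ℕ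
  depthStep f []         = 0
  depthStep f vs@(_ ∷ _) = suc (lowest f vs)

  depthStep-cong : ∀ {f g} vs → (∀ {u} → u ∈ vs → f u ≡ g u) → depthStep f vs ≡ depthStep g vs
  depthStep-cong []         f≡g = refl
  depthStep-cong vs@(_ ∷ _) f≡g = cong suc (lowest-cong vs f≡g)

  depthStep-∈ : ∀ {f u vs} → u ∈ vs → depthStep f vs ≡ suc (lowest f vs)
  depthStep-∈ {vs = _ ∷ _} _ = refl

  private module Depth = Fixpoint 0 (λ f v → depthStep f (back v))
                           (λ v f≡g → depthStep-cong (back v) (f≡g ∘ back-<))

  depth : Fin n → ℕ
  depth = Depth.fix

  depth-back : ∀ {u v} → u ∈ back v → depth v ≡ suc (lowest depth (back v))
  depth-back {v = v} u∈ = trans (Depth.fix-unfold v) (depthStep-∈ u∈)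

  depth-≤suc : ∀ {u v} → u ∈ back v → depth v ≤ suc (depth u)
  depth-≤suc u∈ = ≤-trans (≤-reflexive (depth-back u∈)) (s≤s (lowest-≤ depth u∈))

  depth-attained : ∀ {u v} → u ∈ back v → ∃ λ w → w ∈ back v × depth v ≡ suc (depth w)
  depth-attained u∈ with lowest-attained depth u∈
  ... | w , w∈ , eq = w , w∈ , trans (depth-back u∈) (cong suc eq)

  -- Compare `u` with a vertex `w` of `back v` one layer above `v`. They are equal or adjacent: if
  -- `u` is earlier, induction at `w` applies; if `w` is earlier, `u` is at most one layer below
  -- `w`.
  depth-mono : ∀ v {u} → u ∈ back v → depth u ≤ depth v
  depth-mono = measure-induction _ λ v ih u∈ → step v ih u∈ (depth-attained u∈)
    where
    step : ∀ v → (∀ {w} → ord w < ord v → ∀ {u} → u ∈ back w → depth u ≤ depth w) →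
           ∀ {u} → u ∈ back v → (∃ λ w → w ∈ back v × depth v ≡ suc (depth w)) → depth u ≤ depth v
    step v ih u∈ (w , w∈ , eq) with back-clique v u∈ w∈
    ... | inj₁ refl       = ≤-trans (n≤1+n _) (≤-reflexive (≡-sym eq))
    ... | inj₂ (inj₁ u∈w) = ≤-trans (ih (back-< w∈) u∈w) (≤-trans (n≤1+n _) (≤-reflexive (≡-sym eq)))
    ... | inj₂ (inj₂ w∈u) = ≤-trans (depth-≤suc w∈u) (≤-reflexive (≡-sym eq))

  depth-cases : ∀ {u v} → u ∈ back v → depth u ≢ depth v → suc (depth u) ≡ depth v
  depth-cases {u} {v} u∈ ≢ = ≤-antisym (≤∧≢⇒< (depth-mono v u∈) ≢) (depth-≤suc u∈)

  peers : Fin n → List (Fin n)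
  peers v = filter (λ u → depth u ≟ depth v) (back v)

  ∈-peers⁺ : ∀ {u v} → u ∈ back v → depth u ≡ depth v → u ∈ peers v
  ∈-peers⁺ {v = v} = ∈-filter⁺ (λ u → depth u ≟ depth v)

  ∈-peers⁻ : ∀ {u v} → u ∈ peers v → u ∈ back v × depth u ≡ depth v
  ∈-peers⁻ {v = v} = ∈-filter⁻ (λ u → depth u ≟ depth v)

  near-peers : ∀ {u v} → Near u v → depth u ≡ depth v → u ∈ peers v ⊎ v ∈ peers u
  near-peers (inj₁ u∈) eq = inj₁ (∈-peers⁺ u∈ eq)
  near-peers (inj₂ v∈) eq = inj₂ (∈-peers⁺ v∈ (≡-sym eq))

  clique-peers : ∀ {C} → Clique C → ∀ {u v} → u ∈ C → v ∈ C → depth u ≡ depth v →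
                 u ≡ v ⊎ (u ∈ peers v ⊎ v ∈ peers u)
  clique-peers cl u∈ v∈ eq with cl u∈ v∈
  ... | inj₁ u≡v = inj₁ u≡v
  ... | inj₂ u~v = inj₂ (near-peers u~v eq)

  -- If `back v` is nonempty, one of its vertices lies in the previous layer and is filtered out.
  -- This is where the clique size drops by one.
  peers-length : ∀ v → length (peers v) ≤ k
  peers-length v = bound (back v) (back-length v) λ h∈ → depth-attained h∈
    where
    bound : ∀ bs → length bs ≤ suc k →
            (∀ {u} → u ∈ bs → ∃ λ w → w ∈ bs × depth v ≡ suc (depth w)) →
            length (filter (λ u → depth u ≟ depth v) bs) ≤ k
    bound []       _  _        = z≤n
    bound (h ∷ hs) l≤ attained with attained (here refl)
    ... | w , w∈ , dv≡ = s≤s⁻¹ (≤-trans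
            (filter-notAll (λ u → depth u ≟ depth v) (h ∷ hs)
              (lose w∈ λ dw≡dv → 1+n≢n (≡-sym (trans dw≡dv dv≡))))
            l≤)

  -- The components of this graph are the bags of a tree-partition of H.
  layer : EliminationOrder n k
  layer = record
    { ord         = ord
    ; back        = peers
    ; back-<      = back-< ∘ proj₁ ∘ ∈-peers⁻
    ; back-clique = λ v u∈ w∈ →
        let (u∈b , du) = ∈-peers⁻ u∈ ; (w∈b , dw) = ∈-peers⁻ w∈
        in clique-peers (back-clique v) u∈b w∈b (trans du (≡-sym dw))
    ; back-length = peers-length
    }

  module Layer = EliminationOrder layer

  -- A vertex without peers is the first of its bag, and its whole `back` lies in the previous
  -- layer. Any other vertex copies the value of a peer; `attach-peer` shows that the choice of peer
  -- is immaterial.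
  attachStep : (Fin n → List (Fin n)) → List (Fin n) → List (Fin n) → List (Fin n)
  attachStep f bs []      = bs
  attachStep f bs (h ∷ _) = f h

  attachStep-cong : ∀ {f g} bs ps → (∀ {u} → u ∈ ps → f u ≡ g u) →
                    attachStep f bs ps ≡ attachStep g bs ps
  attachStep-cong bs []      _   = refl
  attachStep-cong bs (_ ∷ _) f≡g = f≡g (here refl)

  private module Attach = Fixpoint [] (λ f v → attachStep f (back v) (peers v))
                            (λ v f≡g → attachStep-cong (back v) (peers v) (f≡g ∘ Layer.back-<))

  -- The clique of the parent bag to which the bag of v is attached.
  attach : Fin n → List (Fin n)
  attach = Attach.fix

  attach-[] : ∀ {v} → peers v ≡ [] → attach v ≡ back v
  attach-[] {v} eq = trans (Attach.fix-unfold v) (cong (attachStep attach (back v)) eq)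

  attach-∷ : ∀ {v h hs} → peers v ≡ h ∷ hs → attach v ≡ attach h
  attach-∷ {v} eq = trans (Attach.fix-unfold v) (cong (attachStep attach (back v)) eq)

  head-∈ : ∀ {v h hs} → peers v ≡ h ∷ hs → h ∈ peers v
  head-∈ {h = h} eq = subst (h ∈_) (≡-sym eq) (here refl)

  -- The peers `u` and `h` of `v` are equal or adjacent, and the induction hypothesis at the later
  -- of the two compares them.
  attach-peer : ∀ v {u} → u ∈ peers v → attach u ≡ attach v
  attach-peer = measure-induction _ λ v ih {u} u∈ → step v ih u∈ (peers v) refl
    where
    step : ∀ v → (∀ {w} → ord w < ord v → ∀ {u} → u ∈ peers w → attach u ≡ attach w) →
           ∀ {u} → u ∈ peers v → ∀ ps → peers v ≡ ps → attach u ≡ attach v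
    step v ih {u} u∈ [] eq with subst (u ∈_) eq u∈
    ... | ()
    step v ih u∈ (h ∷ hs) eq with Layer.back-clique v u∈ (head-∈ eq)
    ... | inj₁ refl       = ≡-sym (attach-∷ eq)
    ... | inj₂ (inj₁ u∈h) = trans (ih (Layer.back-< (head-∈ eq)) u∈h) (≡-sym (attach-∷ eq))
    ... | inj₂ (inj₂ h∈u) = trans (≡-sym (ih (Layer.back-< u∈) h∈u)) (≡-sym (attach-∷ eq))

  -- Following first peers ends at the first vertex `r` of the bag; properties of `attach v` can
  -- then be read off from `back r`.
  attach-root : ∀ v → ∃ λ r → attach v ≡ back r × peers r ≡ [] × depth r ≡ depth v × ord r ≤ ord v
  attach-root = measure-induction _ λ v ih → step v ih (peers v) refl
    where
    Root : Fin n → Set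
    Root v = ∃ λ r → attach v ≡ back r × peers r ≡ [] × depth r ≡ depth v × ord r ≤ ord v
    step : ∀ v → (∀ {w} → ord w < ord v → Root w) → ∀ ps → peers v ≡ ps → Root v
    step v ih []       eq = v , attach-[] eq , eq , refl , ≤-refl
    step v ih (h ∷ hs) eq with ih (Layer.back-< (head-∈ eq))
    ... | r , a≡ , p≡ , d≡ , r≤h =
          r , trans (attach-∷ eq) a≡ , p≡ , trans d≡ (proj₂ (∈-peers⁻ (head-∈ eq))) ,
          ≤-trans r≤h (<⇒≤ (Layer.back-< (head-∈ eq)))

  attach-depth : ∀ {u v} → u ∈ attach v → suc (depth u) ≡ depth v
  attach-depth {u} {v} u∈ with attach-root v
  ... | r , a≡ , p≡ , d≡ , _ = trans (depth-cases u∈r distinct) d≡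
    where
    u∈r : u ∈ back r
    u∈r = subst (u ∈_) a≡ u∈
    distinct : depth u ≢ depth r
    distinct eq with subst (u ∈_) p≡ (∈-peers⁺ u∈r eq)
    ... | ()

  attach-< : ∀ {u v} → u ∈ attach v → ord u < ord v
  attach-< {u} {v} u∈ with attach-root v
  ... | r , a≡ , _ , _ , r≤v = <-≤-trans (back-< (subst (u ∈_) a≡ u∈)) r≤v

  attach-clique : ∀ v → Layer.Clique (attach v)
  attach-clique v {u} {w} u∈ w∈ with attach-root v
  ... | r , a≡ , _ = clique-peers (back-clique r) (subst (u ∈_) a≡ u∈) (subst (w ∈_) a≡ w∈)
                       (suc-injective (trans (attach-depth u∈) (≡-sym (attach-depth w∈))))

  -- This makes the bags a tree-partition. The vertices `u` and `h` of `back v` are adjacent. If `u`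
  -- precedes `h`, induct at `h`; if `h` preceded `u`, monotonicity of depth would put `u` in the
  -- layer of `v`.
  attach-back : ∀ v {u} → u ∈ back v → depth u ≢ depth v → u ∈ attach v
  attach-back = measure-induction _ λ v ih u∈ → step v ih u∈ (peers v) refl
    where
    step : ∀ v → (∀ {w} → ord w < ord v → ∀ {u} → u ∈ back w → depth u ≢ depth w → u ∈ attach w) →
           ∀ {u} → u ∈ back v → ∀ ps → peers v ≡ ps → depth u ≢ depth v → u ∈ attach v
    step v ih {u} u∈ []       eq d≢ = subst (u ∈_) (≡-sym (attach-[] eq)) u∈
    step v ih {u} u∈ (h ∷ hs) eq d≢ with ∈-peers⁻ (head-∈ eq)
    ... | h∈ , dh≡dv with back-clique v u∈ h∈
    ...   | inj₁ refl       = ⊥-elim (d≢ dh≡dv)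
    ...   | inj₂ (inj₁ u∈h) = subst (u ∈_) (≡-sym (attach-∷ eq))
              (ih (back-< h∈) u∈h λ du≡dh → d≢ (trans du≡dh dh≡dv))
    ...   | inj₂ (inj₂ h∈u) = ⊥-elim (d≢ (≤-antisym (depth-mono v u∈)
              (≤-trans (≤-reflexive (≡-sym dh≡dv)) (depth-mono u h∈u))))

  attach-layer : ∀ {C} → Layer.Clique C → ∀ {u v} → u ∈ C → v ∈ C → attach u ≡ attach v
  attach-layer cl u∈ v∈ with cl u∈ v∈
  ... | inj₁ refl       = refl
  ... | inj₂ (inj₁ u∈v) = attach-peer _ u∈v
  ... | inj₂ (inj₂ v∈u) = ≡-sym (attach-peer _ v∈u)

  near-cases : ∀ {u v} → Near u v → Layer.Near u v ⊎ u ∈ attach v ⊎ v ∈ attach u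
  near-cases {u} {v} u~v with depth u ≟ depth v
  ... | yes eq = inj₁ (near-peers u~v eq)
  near-cases {u} {v} (inj₁ u∈) | no d≢ = inj₂ (inj₁ (attach-back v u∈ d≢))
  near-cases {u} {v} (inj₂ v∈) | no d≢ = inj₂ (inj₂ (attach-back u v∈ (d≢ ∘ ≡-sym)))

  near-depth : ∀ {u v} → Layer.Near u v → depth u ≡ depth v
  near-depth (inj₁ u∈) = proj₂ (∈-peers⁻ u∈)
  near-depth (inj₂ v∈) = ≡-sym (proj₂ (∈-peers⁻ v∈))

  -- Extending a layout of the layers to the whole graph

  module Extend {t s : ℕ} (L : CliqueLayout layer t s) where
    open CliqueLayout L

    M : ℕ
    M = suc (sumFin (position ∘ attach))

    bagStep : (Fin n → ℕ) → List (Fin n) → ℕ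
    -- All bags at depth 0 share this number, and other ties may occur. They do no harm: `L` lays
    -- out all bags at once, so its ranks also order the vertices of tied bags without crossings.
    bagStep f []        = 0
    bagStep f C@(h ∷ _) = f h * M + position C

    bagStep-cong : ∀ {f g} C → (∀ {u} → u ∈ C → f u ≡ g u) → bagStep f C ≡ bagStep g C
    bagStep-cong []        _   = refl
    bagStep-cong C@(_ ∷ _) f≡g = cong (λ b → b * M + position C) (f≡g (here refl))

    private module Bag = Fixpoint 0 (λ f v → bagStep f (attach v))
                           (λ v f≡g → bagStep-cong (attach v) (f≡g ∘ attach-<))

    -- Within one depth, bags are ordered by their parent bag, then by the position there of the
    -- clique to which they are attached.
    bag : Fin n → ℕ
    bag = Bag.fix

    bag-cong : ∀ {u v} → attach u ≡ attach v → bag u ≡ bag v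
    bag-cong {u} {v} eq =
      trans (Bag.fix-unfold u) (trans (cong (bagStep bag) eq) (≡-sym (Bag.fix-unfold v)))

    bag-attach : ∀ {u v} → u ∈ attach v → bag v ≡ bag u * M + position (attach v)
    bag-attach {u} {v} u∈ = trans (Bag.fix-unfold v) (step (attach v) (attach-clique v) u∈)
      where
      step : ∀ C → Layer.Clique C → u ∈ C → bagStep bag C ≡ bag u * M + position C
      step C@(_ ∷ _) cl u∈ =
        cong (λ b → b * M + position C) (bag-cong (attach-layer cl (here refl) u∈))

    B R : ℕ
    B = suc (sumFin bag)
    R = suc (sumFin rank)

    -- The radices `B` and `R` exceed all bag numbers and all old ranks, so `rank′` is the
    -- lexicographic order by depth, bag and old rank.
    level rank′ : Fin n → ℕ
    level v = depth v * B + bag v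
    rank′ v = level v * R + rank v

    level-≤ : ∀ {u v} → rank′ u ≤ rank′ v → level u ≤ level v
    level-≤ {v = v} = *+-cancel-≤ R (s≤s (f≤sumFin rank v))

    depth-≤ : ∀ {u v} → level u ≤ level v → depth u ≤ depth v
    depth-≤ {v = v} = *+-cancel-≤ B (s≤s (f≤sumFin bag v))

    rank-< : ∀ {u v} → level u ≡ level v → rank′ u < rank′ v → rank u < rank v
    rank-< {u} {v} eq lt = +-cancelˡ-< (level v * R) _ _
      (subst (λ l → l * R + rank u < level v * R + rank v) eq lt)

    rank′-injective : ∀ {u v} → rank′ u ≡ rank′ v → u ≡ v
    rank′-injective {u} {v} eq = rank-injective (+-cancelˡ-≡ (level v * R) _ _
      (subst (λ l → l * R + rank u ≡ level v * R + rank v) level≡ eq))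
      where
      level≡ : level u ≡ level v
      level≡ = ≤-antisym (level-≤ (≤-reflexive eq)) (level-≤ (≤-reflexive (≡-sym eq)))

    colour′ : Fin n → Fin (3 * (s * t))
    colour′ v = combine (mod3 (depth v)) (combine (cliqueType (attach v)) (colour v))

    colour′-injective : ∀ {u v} → colour′ u ≡ colour′ v →
      mod3 (depth u) ≡ mod3 (depth v) × cliqueType (attach u) ≡ cliqueType (attach v) ×
      colour u ≡ colour v
    colour′-injective eq with combine-injective _ _ _ _ eq
    ... | d≡ , eq′ = d≡ , combine-injective _ _ _ _ eq′

    -- The step from `u` to `v` adds one to the depth, so by the residues the step from `x` to `y`
    -- adds one mod 3; it can then neither stay in a layer nor go up.
    child-parallel : ∀ {u v x y} → u ∈ attach v → Layer.Near x y ⊎ x ∈ attach y ⊎ y ∈ attach x →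
              mod3 (depth u) ≡ mod3 (depth x) → mod3 (depth v) ≡ mod3 (depth y) → x ∈ attach y
    child-parallel u∈ (inj₂ (inj₁ x∈)) _ _ = x∈
    child-parallel {x = x} u∈ (inj₁ x~y) p q = ⊥-elim (cycle3-≢ (mod3 (depth x))
      (trans (cong mod3 (near-depth x~y)) (trans (≡-sym q)
        (trans (cong mod3 (≡-sym (attach-depth u∈))) (cong cycle3 p)))))
    child-parallel {y = y} u∈ (inj₂ (inj₂ y∈)) p q = ⊥-elim (cycle3²-≢ (mod3 (depth y))
      (trans (≡-sym q) (trans (cong mod3 (≡-sym (attach-depth u∈)))
        (cong cycle3 (trans p (cong mod3 (≡-sym (attach-depth y∈))))))))

    proper′ : ∀ {u v} → Near u v → colour′ u ≢ colour′ v
    proper′ {u} {v} u~v eq with colour′-injective eq | near-cases u~v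
    ... | _  , _ , c≡ | inj₁ peer      = proper peer c≡
    ... | d≡ , _ , _  | inj₂ (inj₁ u∈) =
          cycle3-≢ (mod3 (depth u)) (trans d≡ (cong mod3 (≡-sym (attach-depth u∈))))
    ... | d≡ , _ , _  | inj₂ (inj₂ v∈) =
          cycle3-≢ (mod3 (depth v)) (trans (≡-sym d≡) (cong mod3 (≡-sym (attach-depth v∈))))

    -- Each edge stays within one level, and the two inequalities squeeze these levels together;
    -- there the order is that of `L`.
    no-crossing-layer : ∀ {v w x y} → Layer.Near v w → Layer.Near x y → colour v ≡ colour x →
      colour w ≡ colour y → rank′ v < rank′ x → rank′ y < rank′ w → ⊥
    no-crossing-layer {v} {w} {x} {y} v~w x~y cv cw v<x y<w =
      no-crossing v~w x~y cv cw (rank-< vx v<x) (rank-< yw y<w)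
      where
      level-near : ∀ {u u′} → Layer.Near u u′ → level u ≡ level u′
      level-near p = cong₂ (λ d b → d * B + b) (near-depth p) (bag-cong (attach-near p))
        where
        attach-near : ∀ {u u′} → Layer.Near u u′ → attach u ≡ attach u′
        attach-near (inj₁ u∈)  = attach-peer _ u∈
        attach-near (inj₂ u′∈) = ≡-sym (attach-peer _ u′∈)
      v≤x : level v ≤ level x
      v≤x = level-≤ (<⇒≤ v<x)
      y≤w : level y ≤ level w
      y≤w = level-≤ (<⇒≤ y<w)
      vw = level-near v~w
      xy = level-near x~y
      vx : level v ≡ level x
      vx = ≤-antisym v≤x (≤-trans (≤-reflexive xy) (≤-trans y≤w (≤-reflexive (≡-sym vw))))
      yw : level y ≡ level w
      yw = trans (≡-sym xy) (trans (≡-sym vx) vw)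

    -- The inequalities force equal depths at both ends, then equal bag numbers for `v` and `x`. Now
    -- `v` precedes `x` already in `L`, so `attach w` has the smaller position, and `w` should come
    -- before `y`.
    no-crossing-child : ∀ {v w x y} → v ∈ attach w → x ∈ attach y →
      cliqueType (attach w) ≡ cliqueType (attach y) → colour v ≡ colour x →
      rank′ v < rank′ x → rank′ y < rank′ w → ⊥
    no-crossing-child {v} {w} {x} {y} v∈ x∈ same cv v<x y<w =
      <-irrefl refl (<-≤-trans
        (position-< (attach-clique w) (attach-clique y) same v∈ x∈ cv (rank-< level≡ v<x))
        (+-cancelˡ-≤ (bag x * M) _ _
          (subst (λ b → bag x * M + position (attach y) ≤ b * M + position (attach w)) bag≡ by≤)))
      where
      dv≤dx : depth v ≤ depth x
      dv≤dx = depth-≤ (level-≤ (<⇒≤ v<x))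
      dy≤dw : depth y ≤ depth w
      dy≤dw = depth-≤ (level-≤ (<⇒≤ y<w))
      dx≡dv : depth x ≡ depth v
      dx≡dv = ≤-antisym (s≤s⁻¹ (≤-trans (≤-reflexive (attach-depth x∈))
                (≤-trans dy≤dw (≤-reflexive (≡-sym (attach-depth v∈)))))) dv≤dx
      dy≡dw : depth y ≡ depth w
      dy≡dw = trans (≡-sym (attach-depth x∈)) (trans (cong suc dx≡dv) (attach-depth v∈))
      bag-≤ : ∀ {u u′} → depth u ≡ depth u′ → rank′ u < rank′ u′ → bag u ≤ bag u′
      bag-≤ {u} {u′} eq lt = +-cancelˡ-≤ (depth u′ * B) _ _
        (subst (λ d → d * B + bag u ≤ level u′) eq (level-≤ (<⇒≤ lt)))
      by≤ : bag x * M + position (attach y) ≤ bag v * M + position (attach w)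
      by≤ = ≤-trans (≤-reflexive (≡-sym (bag-attach x∈)))
              (≤-trans (bag-≤ dy≡dw y<w) (≤-reflexive (bag-attach v∈)))
      bag≡ : bag v ≡ bag x
      bag≡ = ≤-antisym (bag-≤ (≡-sym dx≡dv) v<x)
               (*+-cancel-≤ M (s≤s (f≤sumFin (position ∘ attach) w)) by≤)
      level≡ : level v ≡ level x
      level≡ = cong₂ (λ d b → d * B + b) (≡-sym dx≡dv) bag≡

    swap-near : ∀ {x y} → Layer.Near x y ⊎ x ∈ attach y ⊎ y ∈ attach x →
                Layer.Near y x ⊎ y ∈ attach x ⊎ x ∈ attach y
    swap-near (inj₁ p)        = inj₁ (Layer.near-sym p)
    swap-near (inj₂ (inj₁ p)) = inj₂ (inj₂ p)
    swap-near (inj₂ (inj₂ p)) = inj₂ (inj₁ p)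

    no-crossing′ : ∀ {v w x y} → Near v w → Near x y → colour′ v ≡ colour′ x →
                   colour′ w ≡ colour′ y → rank′ v < rank′ x → rank′ y < rank′ w → ⊥
    no-crossing′ {v} {w} {x} {y} v~w x~y cv cw v<x y<w =
      let dv , tv , cv′ = colour′-injective cv
          dw , tw , cw′ = colour′-injective cw

          down : v ∈ attach w → x ∈ attach y → ⊥
          down v∈ x∈ = no-crossing-child v∈ x∈ tw cv′ v<x y<w

          up : w ∈ attach v → y ∈ attach x → ⊥
          up w∈ y∈ = no-crossing-child y∈ w∈ (≡-sym tv) (≡-sym cw′) y<w v<x
      in case near-cases v~w , near-cases x~y of λ where
        (inj₂ (inj₁ v∈) , q) → down v∈ (child-parallel v∈ q dv dw)
        (inj₂ (inj₂ w∈) , q) → up w∈ (child-parallel w∈ (swap-near q) dw dv)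
        (p , inj₂ (inj₁ x∈)) → down (child-parallel x∈ p (≡-sym dv) (≡-sym dw)) x∈
        (p , inj₂ (inj₂ y∈)) → up (child-parallel y∈ (swap-near p) (≡-sym dw) (≡-sym dv)) y∈
        (inj₁ p , inj₁ q)    → no-crossing-layer p q cv′ cw′ v<x y<w

    top bottom : List (Fin n) → List (Fin n)
    top    C = filter (λ u → depth u ≟ lowest depth C) C
    bottom C = filter (λ u → ¬? (depth u ≟ lowest depth C)) C

    bagType : List (Fin n) → Fin s
    -- A default is needed for an empty part, and `Fin s` has no evident element; the type of the
    -- empty clique supplies one.
    bagType []      = cliqueType []
    bagType (u ∷ _) = cliqueType (attach u)

    -- `type-colours` compares nonempty cliques only, but the lower part of a nonempty clique may be
    -- empty. This bit, the factor 2 in the number of types, records whether it is.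
    null : List (Fin n) → Fin 2
    null []      = zero
    null (_ ∷ _) = suc zero

    -- A clique meets at most two consecutive layers.
    cliqueType′ : List (Fin n) → Fin (2 * (3 * (s * (s * (s * s)))))
    cliqueType′ C = combine (null (bottom C)) (combine (mod3 (lowest depth C))
      (combine (bagType (top C)) (combine (cliqueType (top C))
        (combine (bagType (bottom C)) (cliqueType (bottom C))))))

    bagType-∈ : ∀ {C u} → Layer.Clique C → u ∈ C → bagType C ≡ cliqueType (attach u)
    bagType-∈ {_ ∷ _} cl u∈ = cong cliqueType (attach-layer cl (here refl) u∈)

    null-∈ : ∀ {C D u} → null C ≡ null D → u ∈ C → ∃ λ v → v ∈ D
    null-∈ {_ ∷ _} {v ∷ _} _ _ = v , here refl

    ∈-top⁻ : ∀ {C u} → u ∈ top C → u ∈ C × depth u ≡ lowest depth C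
    ∈-top⁻ {C} = ∈-filter⁻ (λ u → depth u ≟ lowest depth C)

    clique-depth : ∀ {C u v} → Clique C → u ∈ C → v ∈ C → depth v ≤ suc (depth u)
    clique-depth {v = v} cl u∈ v∈ with cl u∈ v∈
    ... | inj₁ refl       = n≤1+n _
    ... | inj₂ (inj₁ u∈v) = depth-≤suc u∈v
    ... | inj₂ (inj₂ v∈u) = ≤-trans (depth-mono _ v∈u) (n≤1+n _)

    -- Compare `u` with a member of least depth: vertices of a clique differ in depth by at most
    -- one.
    ∈-bottom⁻ : ∀ {C u} → Clique C → u ∈ bottom C → u ∈ C × depth u ≡ suc (lowest depth C)
    ∈-bottom⁻ {C} cl u∈ with ∈-filter⁻ (λ u → ¬? (depth u ≟ lowest depth C)) {xs = C} u∈
    ... | u∈C , d≢ with lowest-attained depth u∈C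
    ...   | w , w∈C , eq = u∈C , ≤-antisym
            (≤-trans (clique-depth cl w∈C u∈C) (≤-reflexive (cong suc (≡-sym eq))))
            (≤∧≢⇒< (lowest-≤ depth u∈C) (d≢ ∘ ≡-sym))

    top-clique : ∀ {C} → Clique C → Layer.Clique (top C)
    top-clique {C} cl u∈ v∈ with ∈-top⁻ {C} u∈ | ∈-top⁻ {C} v∈
    ... | u∈C , du | v∈C , dv = clique-peers cl u∈C v∈C (trans du (≡-sym dv))

    bottom-clique : ∀ {C} → Clique C → Layer.Clique (bottom C)
    bottom-clique cl u∈ v∈ with ∈-bottom⁻ cl u∈ | ∈-bottom⁻ cl v∈
    ... | u∈C , du | v∈C , dv = clique-peers cl u∈C v∈C (trans du (≡-sym dv))

    top-nonempty : ∀ {C u} → u ∈ C → ∃ λ v → v ∈ top C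
    top-nonempty {C} u∈ with lowest-attained depth u∈
    ... | w , w∈ , eq = w , ∈-filter⁺ (λ u → depth u ≟ lowest depth C) w∈ (≡-sym eq)

    -- The three coordinates of `colour′` come from three sources: the residue from the last
    -- hypothesis, the type of the attached clique from `bagType`, and the old colour from
    -- `type-colours`.
    part-colours : ∀ {C D w y} → Layer.Clique C → Layer.Clique D → w ∈ C → y ∈ D →
      bagType C ≡ bagType D → cliqueType C ≡ cliqueType D →
      (∀ {z} → z ∈ D → mod3 (depth w) ≡ mod3 (depth z)) → ∃ λ z → z ∈ D × colour′ w ≡ colour′ z
    part-colours clC clD w∈ y∈ b≡ t≡ d≡ with type-colours clC clD w∈ y∈ t≡
    ... | z , z∈ , c≡ = z , z∈ , cong₂ combine (d≡ z∈) (cong₂ combine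
            (trans (≡-sym (bagType-∈ clC w∈)) (trans b≡ (bagType-∈ clD z∈))) c≡)

    type-colours′ : ∀ {C D w y} → Clique C → Clique D → w ∈ C → y ∈ D →
                    cliqueType′ C ≡ cliqueType′ D → ∃ λ z → z ∈ D × colour′ w ≡ colour′ z
    type-colours′ {C} {D} {w} clC clD w∈ y∈ eq =
      let n≡ , eq₁   = combine-injective _ _ _ _ eq
          d≡ , eq₂   = combine-injective _ _ _ _ eq₁
          b≡ , eq₃   = combine-injective _ _ _ _ eq₂
          t≡ , eq₄   = combine-injective _ _ _ _ eq₃
          b′≡ , t′≡ = combine-injective _ _ _ _ eq₄
      in case depth w ≟ lowest depth C of λ where
        (yes dw) →
          let z , z∈ , c≡ = part-colours (top-clique clC) (top-clique clD)
                (∈-filter⁺ (λ u → depth u ≟ lowest depth C) w∈ dw) (proj₂ (top-nonempty y∈)) b≡ t≡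
                (λ z∈ → trans (cong mod3 dw) (trans d≡ (cong mod3 (≡-sym (proj₂ (∈-top⁻ {D} z∈))))))
          in z , proj₁ (∈-top⁻ {D} z∈) , c≡
        (no dw) →
          let w∈′ = ∈-filter⁺ (λ u → ¬? (depth u ≟ lowest depth C)) w∈ dw
              z , z∈ , c≡ = part-colours (bottom-clique clC) (bottom-clique clD) w∈′
                (proj₂ (null-∈ n≡ w∈′)) b′≡ t′≡
                (λ z∈ → trans (cong mod3 (proj₂ (∈-bottom⁻ clC w∈′)))
                  -- The type records only the residue of the upper layer; the lower one is its
                  -- successor.
                  (trans (cong cycle3 d≡) (cong mod3 (≡-sym (proj₂ (∈-bottom⁻ clD z∈))))))
          in z , proj₁ (∈-bottom⁻ clD z∈) , c≡

    extended : CliqueLayout H (3 * (s * t)) (2 * (3 * (s * (s * (s * s)))))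
    extended = record
      { colour         = colour′
      ; rank           = rank′
      ; rank-injective = rank′-injective
      ; proper         = proper′
      ; no-crossing    = no-crossing′
      ; cliqueType     = cliqueType′
      ; type-colours   = type-colours′
      }

-- Iterating the extension from edgeless graphs

tracks types : ℕ → ℕ
types zero    = 1
types (suc k) = 2 * (3 * (types k * (types k * (types k * types k))))

tracks zero    = 1
tracks (suc k) = 3 * (types k * tracks k)

cliqueLayout₀ : ∀ {n} (H : EliminationOrder n 0) → CliqueLayout H 1 1
cliqueLayout₀ H = record
  { colour         = λ _ → zero
  ; rank           = toℕ
  ; rank-injective = toℕ-injective
  ; proper         = λ u~v → ⊥-elim (edgeless u~v)
  ; no-crossing    = λ v~w _ _ _ _ _ → edgeless v~w
  ; cliqueType     = λ _ → zero
  -- One type serves for all cliques, even the empty one, because `y` witnesses that `D` is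
  -- nonempty.
  ; type-colours   = λ {_} {_} {_} {y} _ _ _ y∈ _ → y , y∈ , refl
  }
  where
  open EliminationOrder H
  empty : ∀ {A : Set} {x : A} xs → length xs ≤ 0 → ¬ x ∈ xs
  empty [] _ ()
  edgeless : ∀ {u v} → ¬ Near u v
  edgeless (inj₁ u∈) = empty _ (back-length _) u∈
  edgeless (inj₂ v∈) = empty _ (back-length _) v∈

cliqueLayout : ∀ k {n} (H : EliminationOrder n k) → CliqueLayout H (tracks k) (types k)
cliqueLayout zero    H = cliqueLayout₀ H
cliqueLayout (suc k) H = Layering.Extend.extended H (cliqueLayout k (Layering.layer H))

-- Walks, simple paths and cycles

module _ {G : Graph} {P : V G → Set} where

  walk-start : ∀ {a b} → WalkIn G P a b → P a
  walk-start (nil p)      = p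
  walk-start (cons p _ _) = p

  walk-++ : ∀ {a b c} → WalkIn G P a b → WalkIn G P b c → WalkIn G P a c
  walk-++ (nil _)       w′ = w′
  walk-++ (cons p e w) w′ = cons p e (walk-++ w w′)

  walk-reverse : ∀ {a b} → WalkIn G P a b → WalkIn G P b a
  walk-reverse (nil p)      = nil p
  walk-reverse (cons p e w) = walk-++ (walk-reverse w) (cons (walk-start w) (Adj-sym G e) (nil p))

-- Cut a walk after its last visit to a.
walk-avoid : ∀ {G P y b} a → a ≢ b → WalkIn G P y b →
             WalkIn G (_≢ a) y b ⊎ ∃ λ c → Adj G a c × WalkIn G (_≢ a) c b
walk-avoid a a≢b (nil _) = inj₁ (nil (a≢b ∘ ≡-sym))
walk-avoid {y = y} a a≢b (cons _ e w) with walk-avoid a a≢b w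
... | inj₂ found = inj₂ found
... | inj₁ w′ with y ≟ᶠ a
...   | yes refl = inj₂ (_ , e , w′)
...   | no y≢a   = inj₁ (cons y≢a e w′)

walk-visit : ∀ {G P y b} a → WalkIn G P y b → WalkIn G (_≢ a) y b ⊎ WalkIn G P a b
walk-visit {y = y} a (nil p) with y ≟ᶠ a
... | yes refl = inj₂ (nil p)
... | no y≢a   = inj₁ (nil y≢a)
walk-visit {y = y} a (cons p e w) with y ≟ᶠ a | walk-visit a w
... | yes refl | _         = inj₂ (cons p e w)
... | no _     | inj₂ w′   = inj₂ w′
... | no y≢a   | inj₁ w′   = inj₁ (cons y≢a e w′)

-- The vertices are kept as a vector index because `Cycle` asks for an injective function on `Fin`,
-- which `lookup` then provides.
data SimplePath (G : Graph) (P : V G → Set) : V G → V G → ∀ {l} → Vec (V G) (suc l) → Set where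
  stop : ∀ {a} → P a → SimplePath G P a a (a ∷ [])
  step : ∀ {a b c l} {xs : Vec (V G) (suc l)} → P a → Adj G a c → SimplePath G P c b xs →
         (∀ i → lookup xs i ≢ a) → SimplePath G P a b (a ∷ xs)

module _ {G : Graph} {P : V G → Set} where

  path-first : ∀ {a b l} {xs : Vec (V G) (suc l)} → SimplePath G P a b xs → lookup xs zero ≡ a
  path-first (stop _)       = refl
  path-first (step _ _ _ _) = refl

  path-last : ∀ {a b l} {xs : Vec (V G) (suc l)} → SimplePath G P a b xs → lookup xs (fromℕ l) ≡ b
  path-last (stop _)       = refl
  path-last (step _ _ p _) = path-last p

  path-all : ∀ {a b l} {xs : Vec (V G) (suc l)} → SimplePath G P a b xs → ∀ i → P (lookup xs i)
  path-all (stop pa)       zero    = pa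
  path-all (step pa _ _ _) zero    = pa
  path-all (step _ _ p _)  (suc i) = path-all p i

  path-adjacent : ∀ {a b l} {xs : Vec (V G) (suc l)} → SimplePath G P a b xs →
                  ∀ i → Adj G (lookup xs (inject₁ i)) (lookup xs (suc i))
  path-adjacent (step {a} _ e p _) zero    = subst (Adj G a) (≡-sym (path-first p)) e
  path-adjacent (step _ _ p@(step _ _ _ _) _) (suc i) = path-adjacent p i

  path-injective : ∀ {a b l} {xs : Vec (V G) (suc l)} → SimplePath G P a b xs →
                   ∀ i j → lookup xs i ≡ lookup xs j → i ≡ j
  path-injective _                zero    zero    _  = refl
  path-injective (step _ _ _ new) zero    (suc j) eq = ⊥-elim (new j (≡-sym eq))
  path-injective (step _ _ _ new) (suc i) zero    eq = ⊥-elim (new i eq)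
  path-injective (step _ _ p _)   (suc i) (suc j) eq = cong suc (path-injective p i j eq)

  path-suffix : ∀ {a b l} {xs : Vec (V G) (suc l)} → SimplePath G P a b xs → ∀ i →
                ∃ λ m → ∃ λ (ys : Vec (V G) (suc m)) → SimplePath G P (lookup xs i) b ys
  path-suffix p@(stop _)       zero    = _ , _ , p
  path-suffix p@(step _ _ _ _) zero    = _ , _ , p
  path-suffix (step _ _ p _)   (suc i) = path-suffix p i

  -- If `a` recurs on the path already erased, the suffix from that occurrence replaces the whole.
  loop-erase : ∀ {a b} → WalkIn G P a b →
               ∃ λ l → ∃ λ (xs : Vec (V G) (suc l)) → SimplePath G P a b xs
  loop-erase (nil p) = _ , _ , stop p
  loop-erase {a} (cons pa e w) with loop-erase w
  ... | _ , xs , p with anyᶠ? (λ i → lookup xs i ≟ᶠ a)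
  ...   | yes (i , refl) = path-suffix p i
  ...   | no new         = _ , _ , step pa e p (λ i eq → new (i , eq))

-- Close the path through `a`, which it avoids. As `c` and `d` differ, the path has at least two
-- vertices, so the cycle has at least three.
path-cycle : ∀ {G a c d l} {xs : Vec (V G) (suc l)} → Adj G a c → Adj G a d → c ≢ d →
             SimplePath G (_≢ a) c d xs → Cycle G
path-cycle e e′ c≢d (stop _) = ⊥-elim (c≢d refl)
path-cycle {G} {a} e e′ c≢d p@(step {l = l} {xs = xs} _ _ _ _) =
  l , lookup (a ∷ _ ∷ xs) , injective , adjacent ,
  subst (λ v → Adj G v a) (≡-sym (path-last p)) (Adj-sym G e′)
  where
  injective : ∀ i j → lookup (a ∷ _ ∷ xs) i ≡ lookup (a ∷ _ ∷ xs) j → i ≡ j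
  injective zero    zero    _  = refl
  injective zero    (suc j) eq = ⊥-elim (path-all p j (≡-sym eq))
  injective (suc i) zero    eq = ⊥-elim (path-all p i eq)
  injective (suc i) (suc j) eq = cong suc (path-injective p i j eq)
  adjacent : ∀ i → Adj G (lookup (a ∷ _ ∷ xs) (inject₁ i)) (lookup (a ∷ _ ∷ xs) (suc i))
  adjacent zero    = e
  adjacent (suc i) = path-adjacent p i

-- Rooted trees and ascents towards the root

module RootedTree (T : Graph) (isTree : IsTree T) (r : V T) where

  -- Two different neighbours of `a` joined by a walk avoiding `a` would give a cycle. Uniqueness of
  -- parents rests on this.
  detour-unique : ∀ {a c d} → Adj T a c → Adj T a d → WalkIn T (_≢ a) c d → c ≡ d
  detour-unique {c = c} {d} e e′ w with c ≟ᶠ d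
  ... | yes c≡d = c≡d
  ... | no  c≢d = ⊥-elim (proj₂ isTree (path-cycle e e′ c≢d (proj₂ (proj₂ (loop-erase w)))))

  toward-root : ∀ x → x ≢ r → ∃ λ c → Adj T x c × WalkIn T (_≢ x) c r
  toward-root x x≢r with walk-avoid x x≢r (proj₁ isTree x r)
  ... | inj₁ w     = ⊥-elim (walk-start w refl)
  ... | inj₂ found = found

  parent : V T → V T
  parent x with x ≟ᶠ r
  ... | yes _  = r
  ... | no x≢r = proj₁ (toward-root x x≢r)

  parent-unique : ∀ {x c} → Adj T x c → WalkIn T (_≢ x) c r → parent x ≡ c
  parent-unique {x} e w with x ≟ᶠ r
  ... | yes refl = ⊥-elim (walk-start (walk-reverse w) refl)
  ... | no x≢r with toward-root x x≢r
  ...   | _ , e′ , w′ = detour-unique e′ e (walk-++ w′ (walk-reverse w))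

  -- The inequality excludes the dummy value `parent r`, which is `r` itself.
  ChildOf : V T → V T → Set
  ChildOf x y = x ≢ r × parent x ≡ y

  detour-child : ∀ {x y} → Adj T x y → WalkIn T (_≢ x) y r → ChildOf x y
  detour-child e w = (λ x≡r → walk-start (walk-reverse w) (≡-sym x≡r)) , parent-unique e w

  -- Take the way from `y` to the root that does not return to `y`. If it misses `x`, then `y` is
  -- the parent of `x`; otherwise its remainder from `x` shows that `x` is the parent of `y`.
  adjacent-child : ∀ {x y} → Adj T x y → ChildOf x y ⊎ ChildOf y x
  adjacent-child {x} {y} e = cases (y ≟ᶠ r)
    where
    y≢x : y ≢ x
    y≢x refl = irrefl T e
    cases : Dec (y ≡ r) → ChildOf x y ⊎ ChildOf y x
    cases (yes refl) = inj₁ (detour-child e (nil y≢x))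
    cases (no y≢r) =
      let c , e′ , w = toward-root y y≢r
      in case walk-visit x w of λ where
        (inj₁ w′) → inj₁ (detour-child e (cons y≢x e′ w′))
        (inj₂ w′) → inj₂ (detour-child (Adj-sym T e) w′)

  -- A relation, because `parent` does not decrease structurally: a derivation certifies that
  -- climbing reaches `r`, and recursion on it is possible.
  data Depth : V T → ℕ → Set where
    root  : Depth r 0
    child : ∀ {x i} → x ≢ r → Depth (parent x) i → Depth x (suc i)

  depth-along : ∀ {x y} → ChildOf x y ⊎ ChildOf y x → ∃ (Depth y) → ∃ (Depth x)
  depth-along (inj₁ (x≢r , refl)) (_ , d)         = _ , child x≢r d
  depth-along (inj₂ (y≢r , _))    (_ , root)      = ⊥-elim (y≢r refl)
  depth-along (inj₂ (_ , refl))   (_ , child _ d) = _ , d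

  depth-exists : ∀ x → ∃ (Depth x)
  depth-exists x = climb (proj₁ isTree x r)
    where
    climb : ∀ {x} → WalkIn T (λ _ → ⊤) x r → ∃ (Depth x)
    climb (nil _)      = 0 , root
    climb (cons _ e w) = depth-along (adjacent-child e) (climb w)

  depth : V T → ℕ
  depth x = proj₁ (depth-exists x)

  depth-functional : ∀ {x i j} → Depth x i → Depth x j → i ≡ j
  depth-functional root          root          = refl
  depth-functional root          (child r≢r _) = ⊥-elim (r≢r refl)
  depth-functional (child r≢r _) root          = ⊥-elim (r≢r refl)
  depth-functional (child _ d)   (child _ d′)  = cong suc (depth-functional d d′)

  depth-parent : ∀ {x} → x ≢ r → depth x ≡ suc (depth (parent x))
  depth-parent {x} x≢r =
    depth-functional (proj₂ (depth-exists x)) (child x≢r (proj₂ (depth-exists (parent x))))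

  data Ascent (P : V T → Set) : V T → V T → Set where
    here : ∀ {x} → P x → Ascent P x x
    up   : ∀ {x y} → P x → x ≢ r → Ascent P (parent x) y → Ascent P x y

  IsTop : (V T → Set) → V T → Set
  IsTop P y = y ≡ r ⊎ ¬ P (parent y)

  module _ {P : V T → Set} where

    ascent-start : ∀ {x y} → Ascent P x y → P x
    ascent-start (here p)   = p
    ascent-start (up p _ _) = p

    ascent-end : ∀ {x y} → Ascent P x y → P y
    ascent-end (here p)   = p
    ascent-end (up _ _ a) = ascent-end a

    ascent-depth : ∀ {x y} → Ascent P x y → depth y ≤ depth x
    ascent-depth (here _)     = ≤-refl
    ascent-depth (up _ x≢r a) = ≤-trans (ascent-depth a)
      (≤-trans (n≤1+n _) (≤-reflexive (≡-sym (depth-parent x≢r))))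

    ascent-exists : (∀ x → Dec (P x)) → ∀ {x i} → Depth x i → P x →
                    ∃ λ y → Ascent P x y × IsTop P y
    ascent-exists P? root px = r , here px , inj₁ refl
    ascent-exists P? {x} (child x≢r d) px with P? (parent x)
    ... | no ¬p = x , here px , inj₂ ¬p
    ... | yes p with ascent-exists P? d p
    ...   | y , a , top = y , up px x≢r a , top

    ascent-unique : ∀ {x y z} → Ascent P x y → IsTop P y → Ascent P x z → IsTop P z → y ≡ z
    ascent-unique (here _)     _          (here _)     _          = refl
    ascent-unique (here _)     (inj₁ x≡r) (up _ x≢r _) _          = ⊥-elim (x≢r x≡r)
    ascent-unique (here _)     (inj₂ ¬p)  (up _ _ a)   _          = ⊥-elim (¬p (ascent-start a))
    ascent-unique (up _ x≢r _) _          (here _)     (inj₁ x≡r) = ⊥-elim (x≢r x≡r)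
    ascent-unique (up _ _ a)   _          (here _)     (inj₂ ¬p)  = ⊥-elim (¬p (ascent-start a))
    ascent-unique (up _ _ a)   ta         (up _ _ b)   tb         = ascent-unique a ta b tb

    -- If `x′` is the child, its ascent cannot stop at `x′`, since the parent `x` satisfies `P`; so
    -- it passes through `x`.
    ascent-child : ∀ {x x′ y} → ChildOf x x′ ⊎ ChildOf x′ x → P x →
                   Ascent P x′ y → IsTop P y → Ascent P x y
    ascent-child (inj₁ (x≢r , refl)) px a _ = up px x≢r a
    ascent-child (inj₂ (x′≢r , _)) px (here _) (inj₁ x′≡r) = ⊥-elim (x′≢r x′≡r)
    ascent-child (inj₂ (_ , refl)) px (here _) (inj₂ ¬px)  = ⊥-elim (¬px px)
    ascent-child (inj₂ (_ , refl)) px (up _ _ a) _         = a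

    ascent-walk : ∀ {x x′ y} → WalkIn T P x x′ → Ascent P x′ y → IsTop P y → Ascent P x y
    ascent-walk (nil _)      a _   = a
    ascent-walk (cons p e w) a top = ascent-child (adjacent-child e) p (ascent-walk w a top) top

  -- From a common start both ascents follow the same parents, so the one that ends higher passes
  -- through the end of the other.
  ascent-meets : ∀ {P Q x y z} → Ascent P x y → Ascent Q x z → depth y ≤ depth z → P z
  ascent-meets a            (here _)     _  = ascent-start a
  ascent-meets (here _)     (up _ x≢r b) le = ⊥-elim (<-irrefl refl
    (≤-trans (≤-reflexive (≡-sym (depth-parent x≢r))) (≤-trans le (ascent-depth b))))
  ascent-meets (up _ _ a) (up _ _ b) le = ascent-meets a b le

-- From a tree-decomposition to an elimination order

elements : ∀ {m} → Subset m → List (Fin m)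
elements []            = []
elements (outside ∷ p) = map suc (elements p)
elements (inside  ∷ p) = zero ∷ map suc (elements p)

∈-elements⁺ : ∀ {m x} {p : Subset m} → x ∈ₛ p → x ∈ elements p
∈-elements⁺ here                      = here refl
∈-elements⁺ {p = outside ∷ p} (there x∈) = ∈-map⁺ suc (∈-elements⁺ x∈)
∈-elements⁺ {p = inside  ∷ p} (there x∈) = there (∈-map⁺ suc (∈-elements⁺ x∈))

∈-elements⁻ : ∀ {m x} (p : Subset m) → x ∈ elements p → x ∈ₛ p
∈-elements⁻ (inside ∷ p) (here refl) = here
∈-elements⁻ (inside ∷ p) (there x∈) with ∈-map⁻ suc x∈
... | _ , y∈ , refl = there (∈-elements⁻ p y∈)
∈-elements⁻ (outside ∷ p) x∈ with ∈-map⁻ suc x∈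
... | _ , y∈ , refl = there (∈-elements⁻ p y∈)

length-elements : ∀ {m} (p : Subset m) → length (elements p) ≡ ∣ p ∣
length-elements []            = refl
length-elements (outside ∷ p) = trans (length-map suc (elements p)) (length-elements p)
length-elements (inside  ∷ p) = cong suc (trans (length-map suc (elements p)) (length-elements p))

Spans : ∀ {G k} → EliminationOrder (n G) k → Set
Spans {G} H = ∀ {u v} → Adj G u v → EliminationOrder.Near H u v

module Elimination {G : Graph} {k : ℕ} (D : TreeDecomposition G k)
                   (r : V (TreeDecomposition.T D)) where
  open TreeDecomposition D
  open RootedTree T isTree r

  InBag : V G → V T → Set
  InBag v x = v ∈ₛ bag x

  summit : ∀ v → ∃ λ y → Ascent (InBag v) (proj₁ (cover v)) y × IsTop (InBag v) y
  summit v = ascent-exists (λ x → v ∈ₛ? bag x) (proj₂ (depth-exists _)) (proj₂ (cover v))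

  top : V G → V T
  top v = proj₁ (summit v)

  ascent-top : ∀ {v x} → InBag v x → Ascent (InBag v) x (top v)
  ascent-top {v} {x} v∈ with summit v
  ... | y , a , isTop = ascent-walk (subtree v x _ v∈ (proj₂ (cover v))) a isTop

  ∈-top : ∀ v → InBag v (top v)
  ∈-top v = ascent-end (ascent-top (proj₂ (cover v)))

  -- By the depth of the highest bag containing the vertex; the index breaks ties.
  ord : V G → ℕ
  ord v = depth (top v) * n G + toℕ v

  ord-injective : ∀ {u v} → ord u ≡ ord v → u ≡ v
  ord-injective {u} {v} eq = toℕ-injective (+-cancelˡ-≡ (depth (top v) * n G) _ _
    (subst (λ d → d * n G + toℕ u ≡ ord v) depth≡ eq))
    where
    depth≡ : depth (top u) ≡ depth (top v)
    depth≡ = ≤-antisym (*+-cancel-≤ (n G) (toℕ<n v) (≤-reflexive eq))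
                       (*+-cancel-≤ (n G) (toℕ<n u) (≤-reflexive (≡-sym eq)))

  ord-total : ∀ {u v} → u ≢ v → ord u < ord v ⊎ ord v < ord u
  ord-total {u} {v} u≢v with ord u <? ord v
  ... | yes u<v = inj₁ u<v
  ... | no  u≮v = inj₂ (≤∧≢⇒< (≮⇒≥ u≮v) (u≢v ∘ ord-injective ∘ ≡-sym))

  back : V G → List (V G)
  back v = filter (λ u → ord u <? ord v) (elements (bag (top v)))

  ∈-back⁻ : ∀ {u v} → u ∈ back v → InBag u (top v) × ord u < ord v
  ∈-back⁻ {v = v} u∈ =
    let u∈′ , u<v = ∈-filter⁻ (λ u → ord u <? ord v) u∈ in ∈-elements⁻ _ u∈′ , u<v

  -- Both vertices ascend from the shared bag, and the top of `u` is not deeper than that of `v`, so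
  -- the ascent of `u` meets `top v`.
  share-back : ∀ {u v x} → InBag u x → InBag v x → ord u < ord v → u ∈ back v
  share-back {u} {v} u∈ v∈ u<v = ∈-filter⁺ (λ u → ord u <? ord v)
    (∈-elements⁺ (ascent-meets (ascent-top u∈) (ascent-top v∈)
      (*+-cancel-≤ (n G) (toℕ<n v) (<⇒≤ u<v)))) u<v

  share-near : ∀ {u v x} → InBag u x → InBag v x → u ≢ v → u ∈ back v ⊎ v ∈ back u
  share-near u∈ v∈ u≢v with ord-total u≢v
  ... | inj₁ u<v = inj₁ (share-back u∈ v∈ u<v)
  ... | inj₂ v<u = inj₂ (share-back v∈ u∈ v<u)

  eliminationOrder : EliminationOrder (n G) k
  eliminationOrder = record
    { ord         = ord
    ; back        = back
    ; back-<      = proj₂ ∘ ∈-back⁻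
    ; back-clique = λ v {u} {w} u∈ w∈ → clique u w (proj₁ (∈-back⁻ u∈)) (proj₁ (∈-back⁻ w∈))
    -- The bag `top v` has at most `suc k` elements, and `v` itself is filtered out.
    ; back-length = λ v → s≤s⁻¹ (≤-trans
        (filter-notAll (λ u → ord u <? ord v) (elements (bag (top v)))
          (lose (∈-elements⁺ (∈-top v)) (<-irrefl refl)))
        (≤-trans (≤-reflexive (length-elements (bag (top v)))) (width (top v))))
    }
    where
    clique : ∀ u w {x} → InBag u x → InBag w x → u ≡ w ⊎ (u ∈ back w ⊎ w ∈ back u)
    clique u w u∈ w∈ with u ≟ᶠ w
    ... | yes u≡w = inj₁ u≡w
    ... | no u≢w  = inj₂ (share-near u∈ w∈ u≢w)

  spans : Spans {G} eliminationOrder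
  spans {u} e = let x , u∈ , v∈ = edgeCov e in
    share-near u∈ v∈ λ u≡v → irrefl G (subst (Adj G u) (≡-sym u≡v) e)

inhabited? : ∀ m → Fin m ⊎ ¬ Fin m
inhabited? zero    = inj₂ λ ()
inhabited? (suc m) = inj₁ zero

eliminationOrder : ∀ {G k} → TreeDecomposition G k → ∃ λ (H : EliminationOrder (n G) k) → Spans {G} H
eliminationOrder {G} {k} D with inhabited? (n (TreeDecomposition.T D))
... | inj₁ r = Elimination.eliminationOrder D r , Elimination.spans D r
-- A tree without nodes covers no vertex, so the graph is empty.
... | inj₂ ¬x = record
      { ord         = λ v → ⊥-elim (¬v v)
      ; back        = λ v → ⊥-elim (¬v v)
      ; back-<      = λ {u} → ⊥-elim (¬v u)
      ; back-clique = λ v → ⊥-elim (¬v v)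
      ; back-length = λ v → ⊥-elim (¬v v)
      } , λ {u} → ⊥-elim (¬v u)
  where
  ¬v : ¬ V G
  ¬v v = ¬x (proj₁ (TreeDecomposition.cover D v))

-- Reading off the track layout

trackLayout : ∀ {G k t s} (H : EliminationOrder (n G) k) → Spans {G} H →
              CliqueLayout H t s → TrackLayout G t
trackLayout H spans L = record
  { col       = colour
  ; proper    = proper ∘ spans
  ; _<ₜ_      = λ u v → colour u ≡ colour v × rank u < rank v
  ; ord-same  = proj₁
  ; ord-irr   = λ u<u → <-irrefl refl (proj₂ u<u)
  ; ord-trans = λ (c , l) (c′ , l′) → trans c c′ , <-trans l l′
  ; ord-total = λ {u} {v} c u≢v → case rank u <? rank v of λ where
      (yes l) → inj₁ (c , l)
      (no ¬l) → inj₂ (≡-sym c , ≤∧≢⇒< (≮⇒≥ ¬l) (u≢v ∘ ≡-sym ∘ rank-injective))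
  ; noX       = λ e e′ c c′ _ (_ , l) (_ , l′) → no-crossing (spans e) (spans e′) c c′ l l′
  }
  where open CliqueLayout L

-- Closed form of the number of tracks

-- This is `(4 ^ k - 3 * k - 1) / 9`, by a recursion that avoids division and truncated subtraction.
exponent : ℕ → ℕ
exponent zero    = 0
exponent (suc k) = 4 * exponent k + k

4^-exponent : ∀ k → 4 ^ k ≡ 1 + (3 * k + exponent k * 9)
4^-exponent zero    = refl
4^-exponent (suc k) = trans (cong (4 *_) (4^-exponent k)) (identity k (exponent k))
  where
  identity : ∀ k e → 4 * (1 + (3 * k + e * 9)) ≡ 1 + (3 * (1 + k) + (4 * e + k) * 9)
  identity = solve-∀

-- The exponent is `(4 ^ k - 1) / 3`: replacing `s` by `6 * s ^ 4` turns an exponent `a` into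
-- `4 * a + 1`.
types-6^ : ∀ k → types k ≡ 6 ^ (3 * exponent k + k)
types-6^ zero    = refl
types-6^ (suc k) = begin
  types (suc k)                      ≡⟨ sixth-power (types k) ⟩
  6 * types k ^ 4                    ≡⟨ cong (λ s → 6 * s ^ 4) (types-6^ k) ⟩
  6 * (6 ^ (3 * exponent k + k)) ^ 4 ≡⟨ cong (6 *_) (^-*-assoc 6 (3 * exponent k + k) 4) ⟩
  6 ^ suc ((3 * exponent k + k) * 4) ≡⟨ cong (6 ^_) (identity k (exponent k)) ⟩
  6 ^ (3 * exponent (suc k) + suc k) ∎
  where
  open ≡-Reasoning
  sixth-power : ∀ s → 2 * (3 * (s * (s * (s * s)))) ≡ 6 * (s * (s * (s * (s * 1))))
  sixth-power = solve-∀
  identity : ∀ k e → 1 + (3 * e + k) * 4 ≡ 3 * (4 * e + k) + (1 + k)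
  identity = solve-∀

tracks-6^ : ∀ k → tracks k ≡ 3 ^ k * 6 ^ exponent k
tracks-6^ zero    = refl
tracks-6^ (suc k) = begin
  3 * (types k * tracks k)
    ≡⟨ cong₂ (λ s t → 3 * (s * t)) (types-6^ k) (tracks-6^ k) ⟩
  3 * (6 ^ (3 * e + k) * (3 ^ k * 6 ^ e))
    ≡⟨ rearrange (6 ^ (3 * e + k)) (3 ^ k) (6 ^ e) ⟩
  3 ^ suc k * (6 ^ (3 * e + k) * 6 ^ e)
    ≡⟨ cong (3 ^ suc k *_) (≡-sym (^-distribˡ-+-* 6 (3 * e + k) e)) ⟩
  3 ^ suc k * 6 ^ (3 * e + k + e)
    ≡⟨ cong (λ i → 3 ^ suc k * 6 ^ i) (identity k e) ⟩
  3 ^ suc k * 6 ^ exponent (suc k) ∎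
  where
  open ≡-Reasoning
  e = exponent k
  rearrange : ∀ a b c → 3 * (a * (b * c)) ≡ 3 * b * (a * c)
  rearrange = solve-∀
  identity : ∀ k e → 3 * e + k + e ≡ 4 * e + k
  identity = solve-∀

exponent-quotient : ∀ k → (4 ^ k ∸ 3 * k ∸ 1) / 9 ≡ exponent k
exponent-quotient k = begin
  (4 ^ k ∸ 3 * k ∸ 1) / 9                          ≡⟨ cong (_/ 9) (∸-+-assoc (4 ^ k) (3 * k) 1) ⟩
  (4 ^ k ∸ (3 * k + 1)) / 9                        ≡⟨ cong (λ p → (p ∸ (3 * k + 1)) / 9) power ⟩
  (3 * k + 1 + exponent k * 9 ∸ (3 * k + 1)) / 9   ≡⟨ cong (_/ 9) (m+n∸m≡n (3 * k + 1) _) ⟩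
  exponent k * 9 / 9                               ≡⟨ m*n/n≡m (exponent k) 9 ⟩
  exponent k                                       ∎
  where
  open ≡-Reasoning
  identity : ∀ k e → 1 + (3 * k + e * 9) ≡ 3 * k + 1 + e * 9
  identity = solve-∀
  power : 4 ^ k ≡ 3 * k + 1 + exponent k * 9
  power = trans (4^-exponent k) (identity k (exponent k))

tracks≡t : ∀ k → tracks k ≡ t k
tracks≡t k = trans (tracks-6^ k) (cong (λ e → 3 ^ k * 6 ^ e) (≡-sym (exponent-quotient k)))

theorem7p3 : (k : ℕ) (G : Graph) → TreeWidthAtMost G k → TrackLayout G (t k)
theorem7p3 k G D = subst (TrackLayout G) (tracks≡t k)
  (let H , spans = eliminationOrder D in trackLayout H spans (cliqueLayout k H))
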